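{- Let $c$ be a prime power, i.e. $c = p^n$ with $p$ prime and $n \ge 1$ an integer. If $(a,b,c)$ and $(a',b',c)$ are triples of positive integers with $a \le b \le c$, $a' \le b' \le c$, and $$a^2+b^2+c^2 = 3abc, \qquad a'^2+b'^2+c^2 = 3a'b'c,$$ then $a = a'$ and $b = b'$.
   Context: A Markoff triple is a triple $(a,b,c)$ of positive integers satisfying the Markoff equation $a^2+b^2+c^2=3abc$; the integers appearing in Markoff triples are called Markoff numbers. The Markoff conjecture states that a Markoff triple $(a,b,c)$ ordered so that $a\le b\le c$ is uniquely determined by $c$. The theorem asserts that this holds whenever $c$ is a prime power. -}

module Defs where

open import Data.Nat using (ℕ; _+_; _*_; _^_; _>_)
open import Data.Nat.Primality using (Prime)
open import Data.Product using (∃₂; _×_)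
open import Relation.Binary.PropositionalEquality using (_≡_)

record MarkoffTriple (a b c : ℕ) : Set where
  field
    a>0      : a > 0
    b>0      : b > 0
    c>0      : c > 0
    equation : a ^ 2 + b ^ 2 + c ^ 2 ≡ 3 * a * b * c

PrimePower : ℕ → Set
PrimePower c = ∃₂ λ p n → Prime p × n > 0 × c ≡ p ^ n

{-# OPTIONS --safe #-}

-- The Markoff triples other than (1,1,1) and (1,1,2) are arranged in a binary
-- tree: a node carries fractions u/a < w/c < v/b whose denominators form a
-- Markoff triple with maximum c, and its children insert one new fraction
-- between u/a and w/c, respectively between w/c and v/b.  Hence a node is found
-- from its middle fraction by binary search, so it is determined by (w , c).
-- Moreover w² ≡ -1 modulo c and 0 ≤ w/c < 1/2, and for a prime power c > 2 these
-- conditions determine w.  Vieta descent shows that every triple occurs in the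
-- tree, up to exchanging a and b.

module Submission where

open import Defs
open import Data.Empty using (⊥)
open import Data.List using ([]; _∷_)
open import Data.Nat
  using (ℕ; zero; suc; _+_; _*_; _^_; _∸_; _≤_; _<_; z≤n; s≤s; s≤s⁻¹; NonZero; >-nonZero)
open import Data.Nat.Coprimality using (Coprime; coprime-divisor) renaming (sym to coprime-sym)
open import Data.Nat.Divisibility
open import Data.Nat.Primality using (Prime; euclidsLemma; prime⇒nonZero; prime⇒irreducible; prime[2])
open import Data.Nat.Properties
open import Data.Nat.Tactic.RingSolver using (solve)
open import Data.Product as Product using (_×_; _,_; ∃; proj₁; proj₂)
open import Data.Sum as Sum using (_⊎_; inj₁; inj₂)
open import Relation.Binary.Construct.Closure.ReflexiveTransitive using (Star; ε; _◅_; _◅◅_)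
open import Relation.Binary.PropositionalEquality using (_≡_; refl; sym; trans; cong; cong₂; subst)
open import Relation.Nullary using (¬_; yes; no; contradiction)

-- Linear combinations of equations: x ≡ y is derived by exhibiting x - y as a
-- combination of the differences of the sides of the hypotheses.

infixr 7 _·_
infixl 6 _⊕_

_·_ : ∀ k {l r} → l ≡ r → k * l ≡ k * r
k · e = cong (k *_) e

_⊕_ : ∀ {l r l′ r′} → l ≡ r → l′ ≡ r′ → l + l′ ≡ r + r′
_⊕_ = cong₂ _+_

linear : ∀ {x y l r} → l ≡ r → x + r ≡ y + l → x ≡ y
linear {x} {y} {l} refl e = +-cancelʳ-≡ l x y e

-- The tree of Markoff triples

infix 8 _∕_

record Frac : Set where
  constructor _∕_
  field
    num den : ℕ

infix 4 _≺_

record _≺_ (p q : Frac) : Set where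
  constructor cross
  open Frac
  field
    cross< : num p * den q < num q * den p

≺-irrefl : ∀ {p q} → p ≡ q → ¬ p ≺ q
≺-irrefl refl (cross p<p) = <-irrefl refl p<p

≺-asym : ∀ {p q} → p ≺ q → ¬ q ≺ p
≺-asym (cross p<q) (cross q<p) = <-asym p<q q<p

≺-trans : ∀ {p q r} → p ≺ q → q ≺ r → p ≺ r
≺-trans {u ∕ a} {w ∕ c} {v ∕ b} (cross p≺q) (cross q≺r) =
  cross (*-cancelʳ-< c (u * b) (v * a) (begin-strict
  u * b * c    ≡⟨ solve (u ∷ b ∷ c ∷ []) ⟩
  b * (u * c)  ≤⟨ *-monoʳ-≤ b (<⇒≤ p≺q) ⟩
  b * (w * a)  ≡⟨ solve (b ∷ w ∷ a ∷ []) ⟩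
  a * (w * b)  <⟨ *-monoʳ-< a {{a≢0}} q≺r ⟩
  a * (v * c)  ≡⟨ solve (a ∷ v ∷ c ∷ []) ⟩
  v * a * c    ∎))
  where
  open ≤-Reasoning
  a≢0 : NonZero a
  a≢0 = m*n≢0⇒n≢0 w {{>-nonZero (≤-<-trans z≤n p≺q)}}

record Node : Set where
  constructor node
  field
    lower mid upper : Frac

open Node using (mid)

infix 4 _↘_

-- The new denominator `d` replaces one outer entry by its Vieta partner, and the new numerator `x`
-- obeys the same recurrence. The additive form avoids truncated subtraction.
data _↘_ : Node → Node → Set where
  left  : ∀ {u a w c v b x d} → d + b ≡ 3 * a * c → x + v ≡ 3 * a * w →
          node (u ∕ a) (w ∕ c) (v ∕ b) ↘ node (u ∕ a) (x ∕ d) (w ∕ c)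
  right : ∀ {u a w c v b x d} → d + a ≡ 3 * b * c → x + u ≡ 3 * b * w →
          node (u ∕ a) (w ∕ c) (v ∕ b) ↘ node (w ∕ c) (x ∕ d) (v ∕ b)

-- The triple (1, 2, 5); the outer fractions 0/1 and 1/2 bound the whole tree.
root : Node
root = node (0 ∕ 1) (2 ∕ 5) (1 ∕ 2)

-- The determinant of the lower or upper pair of neighbouring fractions is the
-- third Markoff number; that of the outer pair is the Vieta partner 3ab - c of c.
record Valid (s : Node) : Set where
  open Node s using (lower; upper)
  open Frac lower   renaming (num to u; den to a)
  open Frac (mid s) renaming (num to w; den to c)
  open Frac upper   renaming (num to v; den to b)
  field
    a>0 : 0 < a
    b>0 : 0 < b
    det-lower : a * w ≡ c * u + b
    det-upper : c * v ≡ b * w + a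
    det-outer : a * v + c ≡ b * u + 3 * a * b
    coprime-ab : Coprime a b
    coprime-ac : Coprime a c
    coprime-bc : Coprime b c

  c>0 : 0 < c
  c>0 = n≢0⇒n>0 λ { refl → <⇒≢ a>0 (sym (m+n≡0⇒n≡0 (b * w) (sym det-upper))) }

  w>0 : 0 < w
  w>0 = n≢0⇒n>0 λ { refl → <⇒≢ b>0 (sym (m+n≡0⇒n≡0 (c * u) (trans (sym det-lower) (*-zeroʳ a)))) }

  lower≺mid : lower ≺ mid s
  lower≺mid = cross (begin-strict
    u * c      ≡⟨ *-comm u c ⟩
    c * u      <⟨ m<m+n (c * u) b>0 ⟩
    c * u + b  ≡⟨ sym det-lower ⟩
    a * w      ≡⟨ *-comm a w ⟩
    w * a      ∎)
    where open ≤-Reasoning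

  mid≺upper : mid s ≺ upper
  mid≺upper = cross (begin-strict
    w * b      ≡⟨ *-comm w b ⟩
    b * w      <⟨ m<m+n (b * w) a>0 ⟩
    b * w + a  ≡⟨ sym det-upper ⟩
    c * v      ≡⟨ *-comm c v ⟩
    v * c      ∎)
    where open ≤-Reasoning

  -- Eliminating `a * w` between `det-lower` and `w` times `det-upper` gives c u + b (w² + 1) = c v
  -- w, and `b` is coprime to `c`.
  mid-sqrt-1 : c ∣ w * w + 1
  mid-sqrt-1 = coprime-divisor (coprime-sym coprime-bc)
    (∣m+n∣m⇒∣n (subst (c ∣_) (sym (eq u a w c v b det-lower det-upper)) (m∣m*n (v * w))) (m∣m*n u))
    where
    eq : ∀ u a w c v b → a * w ≡ c * u + b → c * v ≡ b * w + a →
         c * u + b * (w * w + 1) ≡ c * (v * w)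
    eq u a w c v b det-lower det-upper =
      linear (w · sym det-upper ⊕ sym det-lower) (solve (u ∷ a ∷ w ∷ c ∷ v ∷ b ∷ []))

coprime-+ : ∀ {a b d n} → d + b ≡ n → a ∣ n → Coprime a b → Coprime a d
coprime-+ d+b a∣n coprime (g∣a , g∣d) =
  coprime (g∣a , ∣m+n∣m⇒∣n (subst (_ ∣_) (sym d+b) (∣-trans g∣a a∣n)) g∣d)

root-valid : Valid root
root-valid = record
  { a>0 = s≤s z≤n
  ; b>0 = s≤s z≤n
  ; det-lower = refl
  ; det-upper = refl
  ; det-outer = refl
  ; coprime-ab = λ (g∣1 , _) → ∣1⇒≡1 g∣1
  ; coprime-ac = λ (g∣1 , _) → ∣1⇒≡1 g∣1
  ; coprime-bc = λ (g∣2 , g∣5) → ∣1⇒≡1 (∣m+n∣m⇒∣n {n = 1} g∣5 (∣m⇒∣m*n 2 g∣2))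
  }

-- Determinants are linear in the new fraction. On the left, a x - d u = 3a (a w - c u) - (a v - b
-- u) = 3ab - (3ab - c) = c and d w - c x = c v - b w = a; the right is symmetric.
child-valid : ∀ {s t} → s ↘ t → Valid s → Valid t
child-valid (left {u} {a} {w} {c} {v} {b} {x} {d} d+b x+v) valid = record
  { a>0 = a>0
  ; b>0 = c>0
  ; det-lower = linear (a · x+v ⊕ u · sym d+b ⊕ (3 * a) · det-lower ⊕ sym det-outer)
                       (solve (u ∷ a ∷ w ∷ c ∷ v ∷ b ∷ x ∷ d ∷ []))
  ; det-upper = linear (w · d+b ⊕ c · sym x+v ⊕ det-upper)
                       (solve (a ∷ w ∷ c ∷ v ∷ b ∷ x ∷ d ∷ []))
  ; det-outer = linear (d+b ⊕ det-lower) (solve (u ∷ a ∷ w ∷ c ∷ b ∷ d ∷ []))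
  ; coprime-ab = coprime-ac
  ; coprime-ac = coprime-+ d+b (n∣m*n*o 3 c) coprime-ab
  ; coprime-bc = coprime-+ d+b (n∣m*n (3 * a)) (coprime-sym coprime-bc)
  }
  where open Valid valid
child-valid (right {u} {a} {w} {c} {v} {b} {x} {d} d+a x+u) valid = record
  { a>0 = c>0
  ; b>0 = b>0
  ; det-lower = linear (c · x+u ⊕ w · sym d+a ⊕ det-lower)
                       (solve (u ∷ a ∷ w ∷ c ∷ b ∷ x ∷ d ∷ []))
  ; det-upper = linear (v · d+a ⊕ b · sym x+u ⊕ (3 * b) · det-upper ⊕ sym det-outer)
                       (solve (u ∷ a ∷ w ∷ c ∷ v ∷ b ∷ x ∷ d ∷ []))
  ; det-outer = linear (d+a ⊕ det-upper) (solve (a ∷ w ∷ c ∷ v ∷ b ∷ d ∷ []))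
  ; coprime-ab = coprime-sym coprime-bc
  ; coprime-ac = coprime-+ d+a (n∣m*n (3 * b)) (coprime-sym coprime-ac)
  ; coprime-bc = coprime-+ d+a (n∣m*n*o 3 c) (coprime-sym coprime-ab)
  }
  where open Valid valid

-- Nested intervals and binary search

descendant-valid : ∀ {s t} → Star _↘_ s t → Valid s → Valid t
descendant-valid ε           valid = valid
descendant-valid (step ◅ ps) valid = descendant-valid ps (child-valid step valid)

-- Each step down keeps one bound and moves the other to the parent's middle fraction, so the
-- intervals are nested.
between : ∀ {s t} → Valid s → Star _↘_ s t →
          Node.lower s ≺ mid t × mid t ≺ Node.upper s
between valid ε = Valid.lower≺mid valid , Valid.mid≺upper valid
between valid (step@(left _ _) ◅ ps) =
  let lo , hi = between (child-valid step valid) ps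
  in lo , ≺-trans hi (Valid.mid≺upper valid)
between valid (step@(right _ _) ◅ ps) =
  let lo , hi = between (child-valid step valid) ps
  in ≺-trans (Valid.lower≺mid valid) lo , hi

left-of-mid : ∀ {s l m t} → Valid s → s ↘ node l m (mid s) →
              Star _↘_ (node l m (mid s)) t → mid t ≺ mid s
left-of-mid valid step ps = proj₂ (between (child-valid step valid) ps)

right-of-mid : ∀ {s m r t} → Valid s → s ↘ node (mid s) m r →
               Star _↘_ (node (mid s) m r) t → mid s ≺ mid t
right-of-mid valid step ps = proj₁ (between (child-valid step valid) ps)

-- Comparing the target fraction with `mid s` decides whether a path stops, turns left or turns
-- right, so both paths make the same choice at every node.
mid-injective : ∀ {s t t′} → Valid s → Star _↘_ s t → Star _↘_ s t′ → mid t ≡ mid t′ → t ≡ t′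
mid-injective valid ε ε _ = refl
mid-injective valid ε (step@(left _ _) ◅ ps) eq =
  contradiction (left-of-mid valid step ps) (≺-irrefl (sym eq))
mid-injective valid ε (step@(right _ _) ◅ ps) eq =
  contradiction (right-of-mid valid step ps) (≺-irrefl eq)
mid-injective valid (step@(left _ _) ◅ ps) ε eq =
  contradiction (left-of-mid valid step ps) (≺-irrefl eq)
mid-injective valid (step@(right _ _) ◅ ps) ε eq =
  contradiction (right-of-mid valid step ps) (≺-irrefl (sym eq))
mid-injective valid (step@(left _ _) ◅ ps) (step′@(right _ _) ◅ ps′) eq =
  contradiction (subst (_≺ _) eq (left-of-mid valid step ps)) (≺-asym (right-of-mid valid step′ ps′))
mid-injective valid (step@(right _ _) ◅ ps) (step′@(left _ _) ◅ ps′) eq =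
  contradiction (subst (_ ≺_) eq (right-of-mid valid step ps)) (≺-asym (left-of-mid valid step′ ps′))
mid-injective valid (step@(left {v = v} {b} {x} {d} d+b x+v) ◅ ps)
                    (left {x = x′} {d′} d′+b x′+v ◅ ps′) eq
  -- The parent determines the inserted fraction, so both paths enter the same child.
  with refl ← +-cancelʳ-≡ b d d′ (trans d+b (sym d′+b))
     | refl ← +-cancelʳ-≡ v x x′ (trans x+v (sym x′+v))
  = mid-injective (child-valid step valid) ps ps′ eq
mid-injective valid (step@(right {u} {a} {x = x} {d} d+a x+u) ◅ ps)
                    (right {x = x′} {d′} d′+a x′+u ◅ ps′) eq
  with refl ← +-cancelʳ-≡ a d d′ (trans d+a (sym d′+a))
     | refl ← +-cancelʳ-≡ u x x′ (trans x+u (sym x′+u))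
  = mid-injective (child-valid step valid) ps ps′ eq

-- Vieta descent

squares : ∀ a b c → a ^ 2 + b ^ 2 + c ^ 2 ≡ a * a + b * b + c * c
squares a b c = a · *-identityʳ a ⊕ b · *-identityʳ b ⊕ c · *-identityʳ c

markoff-equation : ∀ {a b c} → MarkoffTriple a b c → a * a + b * b + c * c ≡ 3 * a * b * c
markoff-equation {a} {b} {c} m = trans (sym (squares a b c)) (MarkoffTriple.equation m)

markoff : ∀ {a b c} → 0 < a → 0 < b → 0 < c →
          a * a + b * b + c * c ≡ 3 * a * b * c → MarkoffTriple a b c
markoff {a} {b} {c} a>0 b>0 c>0 eq = record
  { a>0 = a>0 ; b>0 = b>0 ; c>0 = c>0 ; equation = trans (squares a b c) eq }

swap₂₃ : ∀ {a b c} → MarkoffTriple a b c → MarkoffTriple a c b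
swap₂₃ {a} {b} {c} m = markoff a>0 c>0 b>0
  (linear (markoff-equation m) (solve (a ∷ b ∷ c ∷ [])))
  where open MarkoffTriple m

rotate : ∀ {a b c} → MarkoffTriple a b c → MarkoffTriple c a b
rotate {a} {b} {c} m = markoff c>0 a>0 b>0
  (linear (markoff-equation m) (solve (a ∷ b ∷ c ∷ [])))
  where open MarkoffTriple m

-- `c` and `c′` are the two roots of t² - 3ab t + a² + b².
vieta-product : ∀ {a b c c′} → MarkoffTriple a b c → c + c′ ≡ 3 * a * b →
                c * c′ ≡ a * a + b * b
vieta-product {a} {b} {c} {c′} m c+c′ =
  linear (c · c+c′ ⊕ sym (markoff-equation m)) (solve (a ∷ b ∷ c ∷ c′ ∷ []))

vieta-markoff : ∀ {a b c c′} → MarkoffTriple a b c → c + c′ ≡ 3 * a * b → 0 < c′ →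
                MarkoffTriple a b c′
vieta-markoff {a} {b} {c} {c′} m c+c′ c′>0 = markoff a>0 b>0 c′>0
  (linear (c′ · c+c′ ⊕ sym (vieta-product m c+c′)) (solve (a ∷ b ∷ c ∷ c′ ∷ [])))
  where open MarkoffTriple m

vieta-partner : ∀ {a b c} → MarkoffTriple a b c →
                ∃ λ c′ → c + c′ ≡ 3 * a * b × MarkoffTriple a b c′
vieta-partner {a} {b} {c} m = c′ , c+c′ , vieta-markoff m c+c′ c′>0
  where
  open MarkoffTriple m
  c′ = 3 * a * b ∸ c
  c+c′ : c + c′ ≡ 3 * a * b
  -- The subtraction is exact: c² ≤ 3abc by the equation, hence c ≤ 3ab.
  c+c′ = m+[n∸m]≡n (*-cancelʳ-≤ c (3 * a * b) c {{>-nonZero c>0}}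
    (≤-trans (m≤n+m (c * c) (a * a + b * b)) (≤-reflexive (markoff-equation m))))
  product : c * c′ ≡ a * a + b * b
  product = vieta-product m c+c′
  c′>0 : 0 < c′
  c′>0 = n≢0⇒n>0 λ c′≡0 → <⇒≢ (*-mono-< a>0 a>0) (sym (m+n≡0⇒m≡0 (a * a)
    (trans (sym product) (trans (cong (c *_) c′≡0) (*-zeroʳ c)))))

-- Evaluates (b - c) (b - c′) = a² + 2 b² - 3 a b², which is negative.
vieta-partner< : ∀ {a b c c′} → MarkoffTriple a b c → c + c′ ≡ 3 * a * b →
                 a ≤ b → 2 ≤ b → b ≤ c → c′ < b
vieta-partner< {a} {b} {c} {c′} m c+c′ a≤b b≥2 b≤c =
  ≰⇒> λ b≤c′ → impossible b≤c b≤c′ c+c′ (vieta-product m c+c′)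
  where
  open MarkoffTriple m
  open ≤-Reasoning
  instance
    _ = >-nonZero a>0
    _ = >-nonZero b>0
  bound : a * a + 2 * (b * b) < 3 * a * b * b
  bound = begin-strict
    a * a + 2 * (b * b)            ≤⟨ +-monoˡ-≤ _ (*-monoʳ-≤ a a≤b) ⟩
    a * b + 2 * (b * b)            <⟨ +-monoˡ-< _ (m<m*n (a * b) b {{m*n≢0 a b}} b≥2) ⟩
    a * b * b + 2 * (b * b)        ≤⟨ +-monoʳ-≤ (a * b * b) (*-monoʳ-≤ 2 (m≤n*m (b * b) a)) ⟩
    a * b * b + 2 * (a * (b * b))  ≡⟨ solve (a ∷ b ∷ []) ⟩
    3 * a * b * b                  ∎
  impossible : ∀ {c c′} → b ≤ c → b ≤ c′ → c + c′ ≡ 3 * a * b → c * c′ ≡ a * a + b * b → ⊥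
  impossible b≤c b≤c′ s p
    with x , refl ← m≤n⇒∃[o]m+o≡n b≤c | y , refl ← m≤n⇒∃[o]m+o≡n b≤c′
    = <⇒≱ bound (≤-trans (m≤m+n _ (x * y)) (≤-reflexive eq))
    where
    eq : 3 * a * b * b + x * y ≡ a * a + 2 * (b * b)
    eq = linear (p ⊕ b · sym s) (solve (a ∷ b ∷ x ∷ y ∷ []))

-- This makes the descent terminate: the next triple has maximum `b`. If c ≤ b, then c c′ < b²,
-- against c c′ = a² + b².
max-strict : ∀ {a b c} → MarkoffTriple a b c → a ≤ b → 2 ≤ b → b ≤ c → b < c
max-strict {a} {b} {c} m a≤b b≥2 b≤c
  with c′ , c+c′ , _ ← vieta-partner m
  = ≰⇒> λ c≤b → <-irrefl refl (begin-strict
  c * c′         ≤⟨ *-monoˡ-≤ c′ c≤b ⟩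
  b * c′         <⟨ *-monoʳ-< b {{>-nonZero b>0}} (vieta-partner< m c+c′ a≤b b≥2 b≤c) ⟩
  b * b          ≤⟨ m≤n+m (b * b) (a * a) ⟩
  a * a + b * b  ≡⟨ sym (vieta-product m c+c′) ⟩
  c * c′         ∎)
  where
  open MarkoffTriple m
  open ≤-Reasoning

-- Occurrence of every triple in the tree

Occurs : ℕ → ℕ → ℕ → Set
Occurs a b c = ∃ λ ((u , w , v) : ℕ × ℕ × ℕ) → Star _↘_ root (node (u ∕ a) (w ∕ c) (v ∕ b))

extend-left : ∀ {a b c d} → a ≤ d → d + b ≡ 3 * a * c → Occurs a b c → Occurs a c d
extend-left {a} {b} {c} {d} a≤d d+b ((u , w , v) , ps) =
  (u , 3 * a * w ∸ v , w) , ps ◅◅ (left d+b (m∸n+n≡m v≤3aw) ◅ ε)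
  where
  open Valid (descendant-valid ps root-valid)
  open ≤-Reasoning
  -- Needed for the numerator `3 * a * w ∸ v` to be exact; `a ≤ d` enters through a ≤ d w.
  v≤3aw : v ≤ 3 * a * w
  v≤3aw = *-cancelˡ-≤ c {{>-nonZero c>0}} (begin
    c * v            ≡⟨ det-upper ⟩
    b * w + a        ≤⟨ +-monoʳ-≤ (b * w) (≤-trans a≤d (m≤m*n d w {{>-nonZero w>0}})) ⟩
    b * w + d * w    ≡⟨ linear (w · d+b) (solve (a ∷ b ∷ c ∷ d ∷ w ∷ [])) ⟩
    c * (3 * a * w)  ∎)

extend-right : ∀ {a b c d} → d + a ≡ 3 * b * c → Occurs a b c → Occurs c b d
extend-right {a} {b} {c} {d} d+a ((u , w , v) , ps) =
  (w , 3 * b * w ∸ u , v) , ps ◅◅ (right d+a (m∸n+n≡m u≤3bw) ◅ ε)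
  where
  open Valid (descendant-valid ps root-valid)
  open ≤-Reasoning
  u≤3bw : u ≤ 3 * b * w
  u≤3bw = *-cancelˡ-≤ c {{>-nonZero c>0}} (begin
    c * u            ≤⟨ m≤m+n (c * u) b ⟩
    c * u + b        ≡⟨ sym det-lower ⟩
    a * w            ≤⟨ m≤n+m (a * w) (d * w) ⟩
    d * w + a * w    ≡⟨ linear (w · d+a) (solve (a ∷ b ∷ c ∷ d ∷ w ∷ [])) ⟩
    c * (3 * b * w)  ∎)

-- With b the old maximum and c the new one, the old middle node becomes a
-- bound of its child.
extend : ∀ {a b c c′} → a ≤ c → c + c′ ≡ 3 * a * b →
         Occurs a c′ b ⊎ Occurs c′ a b → Occurs a b c ⊎ Occurs b a c
extend a≤c c+c′ (inj₁ o) = inj₁ (extend-left a≤c c+c′ o)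
extend a≤c c+c′ (inj₂ o) = inj₂ (extend-right c+c′ o)

max-of-1-1 : ∀ {c} → MarkoffTriple 1 1 c → c ≤ 2
max-of-1-1 {c} m = ≮⇒≥ λ c≥3 → <-irrefl refl (begin-strict
  3 * c      ≤⟨ *-monoˡ-≤ c c≥3 ⟩
  c * c      <⟨ m<n+m (c * c) {2} (s≤s z≤n) ⟩
  2 + c * c  ≡⟨ markoff-equation m ⟩
  3 * c      ∎)
  where open ≤-Reasoning

-- Induction on a bound `n` for the maximum. Replacing `c` by `c′` leaves a triple with maximum `b`;
-- if `a` and `c′` are both 1 the triple is the root, otherwise the larger of them is at least 2 and
-- the hypothesis applies.
every-triple-occurs : ∀ n {a b c} → c ≤ n → MarkoffTriple a b c → a ≤ b → 2 ≤ b → b ≤ c →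
                      Occurs a b c ⊎ Occurs b a c
every-triple-occurs zero c≤0 m a≤b b≥2 b≤c = contradiction (≤-trans b≥2 (≤-trans b≤c c≤0)) λ ()
every-triple-occurs (suc n) {a} {b} {c} c≤1+n m a≤b b≥2 b≤c
  with c′ , c+c′ , m′ ← vieta-partner m
  = cases (≤-total a c′)
  where
  open MarkoffTriple m using (a>0)
  c′<b : c′ < b
  c′<b = vieta-partner< m c+c′ a≤b b≥2 b≤c
  b≤n : b ≤ n
  b≤n = s≤s⁻¹ (≤-trans (max-strict m a≤b b≥2 b≤c) c≤1+n)
  a≤c : a ≤ c
  a≤c = ≤-trans a≤b b≤c

  base : a ≡ 1 → c′ ≡ 1 → Occurs a b c ⊎ Occurs b a c
  base refl refl
    -- The partner triple is (1, 1, b), so b = 2, and c + 1 = 6.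
    with refl ← ≤-antisym b≥2 (max-of-1-1 (swap₂₃ m′))
    with refl ← +-cancelʳ-≡ 1 c 5 c+c′
    = inj₁ ((0 , 2 , 1) , ε)

  cases : a ≤ c′ ⊎ c′ ≤ a → Occurs a b c ⊎ Occurs b a c
  cases (inj₁ a≤c′) with m≤n⇒m<n∨m≡n (MarkoffTriple.c>0 m′)
  ... | inj₁ c′≥2 = extend a≤c c+c′ (every-triple-occurs n b≤n (swap₂₃ m′) a≤c′ c′≥2 (<⇒≤ c′<b))
  ... | inj₂ 1≡c′ = base (≤-antisym (subst (a ≤_) (sym 1≡c′) a≤c′) a>0) (sym 1≡c′)
  cases (inj₂ c′≤a) with m≤n⇒m<n∨m≡n a>0
  ... | inj₁ a≥2 = extend a≤c c+c′ (Sum.swap (every-triple-occurs n b≤n (rotate m′) c′≤a a≥2 a≤b))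
  ... | inj₂ 1≡a = base (sym 1≡a) (≤-antisym (subst (c′ ≤_) (sym 1≡a) c′≤a) (MarkoffTriple.c>0 m′))

-- Square roots of -1 modulo a prime power

-- Euclid's lemma moves one factor `p` into `y`; cancelling it lowers the exponent.
^-∣-cancelˡ : ∀ {p x y} n → Prime p → ¬ p ∣ x → p ^ n ∣ x * y → p ^ n ∣ y
^-∣-cancelˡ zero pp p∤x _ = 1∣ _
^-∣-cancelˡ {p} {x} {y} (suc n) pp p∤x pⁿ⁺¹∣xy
  with euclidsLemma x y pp (∣-trans (m∣m*n (p ^ n)) pⁿ⁺¹∣xy)
... | inj₁ p∣x = contradiction p∣x p∤x
... | inj₂ (divides q refl) = subst (p ^ suc n ∣_) (*-comm p q)
  (*-monoʳ-∣ p (^-∣-cancelˡ n pp p∤x (*-cancelˡ-∣ p {{prime⇒nonZero pp}}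
    (subst (p ^ suc n ∣_) eq pⁿ⁺¹∣xy))))
  where
  eq : x * (q * p) ≡ p * (x * q)
  eq = solve (x ∷ q ∷ p ∷ [])

∣-<⇒≡0 : ∀ {m n} → m ∣ n → n < m → n ≡ 0
∣-<⇒≡0 {n = zero}  _   _   = refl
∣-<⇒≡0 {n = suc n} m∣n n<m = contradiction (∣⇒≤ m∣n) (<⇒≱ n<m)

prime∣⇒∤+1 : ∀ {p} w → Prime p → p ∣ w → ¬ p ∣ w * w + 1
prime∣⇒∤+1 w pp p∣w p∣w²+1 with refl ← ∣1⇒≡1 (∣m+n∣m⇒∣n p∣w²+1 (∣m⇒∣m*n w p∣w)) =
  contradiction pp λ ()

even⊎odd : ∀ n → ∃ λ k → n ≡ k * 2 ⊎ n ≡ 1 + k * 2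
even⊎odd zero = 0 , inj₁ refl
even⊎odd (suc n) with even⊎odd n
... | k , inj₁ refl = k , inj₂ refl
... | k , inj₂ refl = suc k , inj₁ refl

4∤w²+1 : ∀ w → ¬ 4 ∣ w * w + 1
4∤w²+1 w 4∣w²+1 with even⊎odd w
... | k , inj₁ refl = prime∣⇒∤+1 w prime[2] (n∣m*n k) (∣-trans (m∣m*n 2) 4∣w²+1)
... | k , inj₂ refl = contradiction
  (∣⇒≤ (∣m+n∣m⇒∣n {n = 2} (subst (4 ∣_) eq 4∣w²+1) (m∣m*n (k * k + k)))) λ { (s≤s (s≤s ())) }
  where
  eq : (1 + k * 2) * (1 + k * 2) + 1 ≡ 4 * (k * k + k) + 2
  eq = solve (k ∷ [])

∣2⇒≡2 : ∀ {p} → Prime p → p ∣ 2 → p ≡ 2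
∣2⇒≡2 pp p∣2 with prime⇒irreducible prime[2] p∣2
... | inj₁ refl = contradiction pp λ ()
... | inj₂ p≡2 = p≡2

-- If `p` divides `w`, it divides 1. If p = 2, then `p ^ n` exceeds 2 and is a multiple of 4, but w²
-- + 1 never is.
sqrt-1-prime∤2w : ∀ {p} w n → Prime p → 2 < p ^ n → p ^ n ∣ w * w + 1 → ¬ p ∣ w + w
sqrt-1-prime∤2w w zero _ (s≤s ())
sqrt-1-prime∤2w {p} w (suc n) pp pⁿ>2 pⁿ∣w²+1 p∣2w
  with euclidsLemma 2 w pp (subst (p ∣_) (cong (w +_) (sym (+-identityʳ w))) p∣2w)
... | inj₂ p∣w = prime∣⇒∤+1 w pp p∣w (∣-trans (m∣m*n (p ^ n)) pⁿ∣w²+1)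
... | inj₁ p∣2 with refl ← ∣2⇒≡2 pp p∣2 = 4∤w²+1 w (∣-trans (4∣2^ n pⁿ>2) pⁿ∣w²+1)
  where
  4∣2^ : ∀ n → 2 < 2 ^ suc n → 4 ∣ 2 ^ suc n
  4∣2^ zero (s≤s (s≤s ()))
  4∣2^ (suc n) _ = divides (2 ^ n) (power (2 ^ n))
    where
    power : ∀ k → 2 * (2 * k) ≡ k * 4
    power k = solve (k ∷ [])

-- `p ^ n` divides (w - w′)(w + w′). The factors differ by 2w′, so `p` misses one of them and
-- `p ^ n` divides the other, which is smaller than `p ^ n` and hence 0.
sqrt-1-unique-≤ : ∀ {p} w w′ n → Prime p → 2 < p ^ n → p ^ n ∣ w * w + 1 → p ^ n ∣ w′ * w′ + 1 →
                  2 * w < p ^ n → w′ ≤ w → w ≡ w′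
sqrt-1-unique-≤ {p} w w′ n pp c>2 c∣w²+1 c∣w′²+1 2w<c w′≤w
  with x , refl ← m≤n⇒∃[o]m+o≡n w′≤w
  = trans (cong (w′ +_) x≡0) (+-identityʳ w′)
  where
  2w′+x<c : w′ + w′ + x < p ^ n
  2w′+x<c = ≤-<-trans (≤-trans (m≤m+n (w′ + w′ + x) x) (≤-reflexive eq)) 2w<c
    where
    eq : w′ + w′ + x + x ≡ 2 * (w′ + x)
    eq = solve (w′ ∷ x ∷ [])
  c∣product : p ^ n ∣ x * (w′ + w′ + x)
  c∣product = ∣m+n∣m⇒∣n (subst (p ^ n ∣_) eq c∣w²+1) c∣w′²+1
    where
    eq : (w′ + x) * (w′ + x) + 1 ≡ w′ * w′ + 1 + x * (w′ + w′ + x)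
    eq = solve (w′ ∷ x ∷ [])
  x≡0 : x ≡ 0
  x≡0 with p ∣? x
  ... | no p∤x = m+n≡0⇒n≡0 (w′ + w′) (∣-<⇒≡0 (^-∣-cancelˡ n pp p∤x c∣product) 2w′+x<c)
  ... | yes p∣x = ∣-<⇒≡0
    (^-∣-cancelˡ n pp p∤sum (subst (p ^ n ∣_) (*-comm x (w′ + w′ + x)) c∣product))
    (≤-<-trans (m≤n+m x (w′ + w′)) 2w′+x<c)
    where
    p∤sum : ¬ p ∣ w′ + w′ + x
    p∤sum p∣sum = sqrt-1-prime∤2w w′ n pp c>2 c∣w′²+1
      (∣m+n∣m⇒∣n (subst (p ∣_) (+-comm (w′ + w′) x) p∣sum) p∣x)

sqrt-1-unique : ∀ {c} w w′ → PrimePower c → 2 < c → c ∣ w * w + 1 → c ∣ w′ * w′ + 1 →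
                2 * w < c → 2 * w′ < c → w ≡ w′
sqrt-1-unique w w′ (p , n , pp , _ , refl) c>2 c∣w²+1 c∣w′²+1 2w<c 2w′<c with ≤-total w′ w
... | inj₁ w′≤w = sqrt-1-unique-≤ w w′ n pp c>2 c∣w²+1 c∣w′²+1 2w<c w′≤w
... | inj₂ w≤w′ = sym (sqrt-1-unique-≤ w′ w n pp c>2 c∣w′²+1 c∣w²+1 2w′<c w≤w′)

-- Uniqueness of the triple with a given maximum

mid-sqrt-1 : ∀ {l w c r} → Star _↘_ root (node l (w ∕ c) r) → c ∣ w * w + 1
mid-sqrt-1 ps = Valid.mid-sqrt-1 (descendant-valid ps root-valid)

mid<½ : ∀ {l w c r} → Star _↘_ root (node l (w ∕ c) r) → 2 * w < c
mid<½ {w = w} {c} ps = begin-strict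
  2 * w  ≡⟨ *-comm 2 w ⟩
  w * 2  <⟨ _≺_.cross< (proj₂ (between root-valid ps)) ⟩
  1 * c  ≡⟨ *-identityˡ c ⟩
  c      ∎
  where open ≤-Reasoning

occurrence-unique : ∀ {a b a′ b′ c} → PrimePower c → 2 < c →
                    Occurs a b c → Occurs a′ b′ c → a ≡ a′ × b ≡ b′
occurrence-unique ppc c>2 ((_ , w , _) , ps) ((_ , w′ , _) , ps′)
  with refl ← sqrt-1-unique w w′ ppc c>2
                 (mid-sqrt-1 ps) (mid-sqrt-1 ps′) (mid<½ ps) (mid<½ ps′)
  with refl ← mid-injective root-valid ps ps′ refl
  = refl , refl

max-1 : ∀ {a b c} → MarkoffTriple a b c → a ≤ b → 1 ≡ b → 1 ≡ a × c ≤ 2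
max-1 m a≤b refl with refl ← ≤-antisym a≤b (MarkoffTriple.a>0 m) = refl , max-of-1-1 m

max>2 : ∀ {a b c} → MarkoffTriple a b c → a ≤ b → 2 ≤ b → b ≤ c → 2 < c
max>2 m a≤b b≥2 b≤c = ≤-<-trans b≥2 (max-strict m a≤b b≥2 b≤c)

-- For two sorted triples occurring in opposite orientations: a ≤ b = a′ ≤ b′ = a.
sorted-crossed : ∀ {a b a′ b′} → a ≤ b → a′ ≤ b′ → a ≡ b′ × b ≡ a′ → a ≡ a′ × b ≡ b′
sorted-crossed a≤b a′≤b′ (refl , refl) = ≤-antisym a≤b a′≤b′ , ≤-antisym a′≤b′ a≤b

theorem1p1 : ∀ (a b a′ b′ c : ℕ) → PrimePower c →
    MarkoffTriple a b c → a ≤ b → b ≤ c →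
    MarkoffTriple a′ b′ c → a′ ≤ b′ → b′ ≤ c →
    a ≡ a′ × b ≡ b′
theorem1p1 a b a′ b′ c ppc m a≤b b≤c m′ a′≤b′ b′≤c
  with m≤n⇒m<n∨m≡n (MarkoffTriple.b>0 m) | m≤n⇒m<n∨m≡n (MarkoffTriple.b>0 m′)
... | inj₂ 1≡b | inj₂ 1≡b′ =
  trans (sym (proj₁ (max-1 m a≤b 1≡b))) (proj₁ (max-1 m′ a′≤b′ 1≡b′)) , trans (sym 1≡b) 1≡b′
-- The mixed cases clash: b ≥ 2 forces c > 2, while b′ = 1 forces c ≤ 2.
... | inj₁ b≥2 | inj₂ 1≡b′ =
  contradiction (max>2 m a≤b b≥2 b≤c) (≤⇒≯ (proj₂ (max-1 m′ a′≤b′ 1≡b′)))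
... | inj₂ 1≡b | inj₁ b′≥2 =
  contradiction (max>2 m′ a′≤b′ b′≥2 b′≤c) (≤⇒≯ (proj₂ (max-1 m a≤b 1≡b)))
... | inj₁ b≥2 | inj₁ b′≥2
  with every-triple-occurs c ≤-refl m a≤b b≥2 b≤c
     | every-triple-occurs c ≤-refl m′ a′≤b′ b′≥2 b′≤c
     | max>2 m a≤b b≥2 b≤c
... | inj₁ o | inj₁ o′ | c>2 = occurrence-unique ppc c>2 o o′
... | inj₂ o | inj₂ o′ | c>2 = Product.swap (occurrence-unique ppc c>2 o o′)
... | inj₁ o | inj₂ o′ | c>2 = sorted-crossed a≤b a′≤b′ (occurrence-unique ppc c>2 o o′)
... | inj₂ o | inj₁ o′ | c>2 = sorted-crossed a≤b a′≤b′ (Product.swap (occurrence-unique ppc c>2 o o′))
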